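{- Let $N\ge9$, $\alpha\in\{2,3,4\}$ with $\alpha\mid N$, and $M_\alpha=N/\alpha$. Let $g$ be a $2\times5$ matrix over $\mathbb{Z}_N$ generating an admissible linear code, with columns indexed by $i=0,\dots,4$ and $\gcd_i=\gcd(g_{1i},g_{2i},N)$. Suppose exactly one column of $g$ has $\gcd_i=M_\alpha$ and the other columns have $\gcd_i<M_\alpha$. Then $g$ does not generate a thin linear code, unless $g$ has a column of zeros.
   Context: $\mathbb{Z}_N=\mathbb{Z}/N\mathbb{Z}$; its elements are identified with the representatives $0,1,\dots,N-1$, and gcd's are taken of these integers. The code generated by $g$ is the submodule of $\mathbb{Z}_N^5$ generated by the rows of $g$. A linear code is extended if every word has coordinate sum $0\bmod N$; call it admissible if it is extended and the greatest common divisor of $N$ and all entries of all words (equivalently of $N$ and all entries of $g$) is $1$. An extended code is thin if it contains no word all of whose entries are nonzero. -}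

module Defs where

open import Data.Fin.Base using (Fin; toℕ; zero; suc)
open import Data.Nat.Base using (ℕ; _+_; _*_; _%_; NonZero)
open import Data.Nat.Divisibility using (_∣_)
open import Data.Nat.DivMod using (_mod_)
open import Data.Nat.GCD using (gcd)
open import Data.Product.Base using (_×_; ∃; ∃₂)
open import Data.Sum.Base using (_⊎_)
open import Data.Vec.Base using (Vec; lookup; map; replicate; sum; zipWith)
open import Data.Vec.Relation.Unary.All using (All)
open import Level using (0ℓ)
open import Relation.Binary.PropositionalEquality using (_≡_; _≢_)
open import Relation.Nullary.Negation using (¬_)
open import Relation.Unary using (Pred)

-- ℤ/Nℤ through the representatives 0, …, N - 1.
ℤₘ : ℕ → Set
ℤₘ N = Fin N

Word : ℕ → ℕ → Set
Word N n = Vec (ℤₘ N) n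

-- A vector of rows.
Matrix : ℕ → ℕ → ℕ → Set
Matrix N k n = Vec (Word N n) k

Code : ℕ → ℕ → Set₁
Code N n = Pred (Word N n) 0ℓ

record IsGCDOf (P : Pred ℕ 0ℓ) (d : ℕ) : Set where
  field
    commonDivisor : ∀ {m} → P m → d ∣ m
    greatest      : ∀ {c} → (∀ {m} → P m → c ∣ m) → c ∣ d

module _ {N : ℕ} .{{_ : NonZero N}} where

  0ₘ : ℤₘ N
  0ₘ = 0 mod N

  infixl 6 _+ₘ_
  infixl 7 _*ₘ_

  _+ₘ_ : ℤₘ N → ℤₘ N → ℤₘ N
  x +ₘ y = (toℕ x + toℕ y) mod N

  _*ₘ_ : ℤₘ N → ℤₘ N → ℤₘ N
  x *ₘ y = (toℕ x * toℕ y) mod N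

  -- The smallest ℤ/Nℤ-submodule containing the rows of g.
  data GeneratedCode {k n : ℕ} (g : Matrix N k n) : Code N n where
    row   : ∀ r → GeneratedCode g (lookup g r)
    zeroʷ : GeneratedCode g (replicate n 0ₘ)
    add   : ∀ {v w} → GeneratedCode g v → GeneratedCode g w →
            GeneratedCode g (zipWith _+ₘ_ v w)
    scale : ∀ c {w} → GeneratedCode g w → GeneratedCode g (map (c *ₘ_) w)

  Extended : ∀ {n} → Code N n → Set
  Extended C = ∀ {w} → C w → sum (map toℕ w) % N ≡ 0

  ModulusOrEntry : ∀ {n} → Code N n → Pred ℕ 0ℓ
  ModulusOrEntry C m = m ≡ N ⊎ (∃₂ λ w i → C w × m ≡ toℕ (lookup w i))

  Admissible : ∀ {n} → Code N n → Set
  Admissible C = Extended C × IsGCDOf (ModulusOrEntry C) 1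

  Thin : ∀ {n} → Code N n → Set
  Thin C = Extended C × ¬ (∃ λ w → C w × All (_≢ 0ₘ) w)

  HasZeroColumn : ∀ {k n} → Matrix N k n → Set
  HasZeroColumn g = ∃ λ i → ∀ r → lookup (lookup g r) i ≡ 0ₘ

columnGcd : ∀ {N n} → Matrix N 2 n → Fin n → ℕ
columnGcd {N} g i = gcd (gcd (entry zero) (entry (suc zero))) N
  where
  entry : Fin 2 → ℕ
  entry r = toℕ (lookup (lookup g r) i)

{-# OPTIONS --safe #-}
module Submission where

-- The zero sets K_i of the five columns are subgroups of (ℤ/N)² of index n_i = N / gcd_i, and thinness
-- says that they cover. Inside the coset X on which the special column j equals N / α, each K_i (i ≠ j)
-- has density at most 1 / n_i. Since the columns sum to zero and have content 1, N divides the lcm of any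
-- four of the n_i. If all n_i ≥ 4 (i ≠ j), covering X forces them all to be 4, so N ∣ 4. Otherwise α = 2,
-- and the density bound together with the lcm condition and N ≥ 9 leaves only the sorted tuples
-- (3,4,4,6) and (3,3,4,12), where X would have to be partitioned although zero sets of index 3 and 4
-- meet in X, and (3,3,4,4), where a point outside all zero sets is glued from its 3-part and its 4-part.

open import Defs
open import Data.Empty using (⊥)
open import Data.Fin.Base using (Fin; zero; suc; toℕ; punchIn; punchOut)
open import Data.Fin.Properties using (any?; toℕ-fromℕ<; punchInᵢ≢i; punchIn-punchOut) renaming (_≟_ to _≟ᶠ_)
open import Data.List.Base using (List; []; _∷_; map; allFin)
open import Data.List.Membership.Propositional using (_∈_; lose)
open import Data.List.Membership.Propositional.Properties using (∈-allFin; ∈-map⁺; ∈-map⁻)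
open import Data.List.Relation.Binary.Permutation.Propositional using (_↭_; ↭-sym)
open import Data.List.Relation.Binary.Permutation.Propositional.Properties using (∈-resp-↭; ↭-length)
open import Data.List.Relation.Binary.Pointwise.Base using (Pointwise; []; _∷_)
open import Data.List.Relation.Unary.All as All using (All; []; _∷_)
open import Data.List.Relation.Unary.All.Properties using (All¬⇒¬Any)
open import Data.List.Relation.Unary.Any as Any using (Any; here; there)
open import Data.List.Relation.Unary.Linked using ([-]; _∷_)
open import Data.Nat.Base using (ℕ; zero; suc; pred; _+_; _*_; _∸_; _/_; _%_; _≤_; _<_; s≤s; z≤n; z<s; NonZero; >-nonZero; >-nonZero⁻¹; ≢-nonZero; ≢-nonZero⁻¹)
open import Data.Nat.Coprimality using (coprime-divisor; coprime-/gcd)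
open import Data.Nat.Divisibility
open import Data.Nat.DivMod using (_mod_; m%n<n; m%n%n≡m%n; m<n⇒m%n≡m; m/n*n≡m; [m+kn]%n≡m%n; %-remove-+ˡ; %-remove-+ʳ; %-distribˡ-+; %-distribˡ-*)
open import Data.Nat.GCD using (gcd; gcd-GCD; gcd[m,n]∣m; gcd[m,n]∣n; module Bézout)
open import Data.Nat.ListAction using () renaming (sum to sumᴸ)
open import Data.Nat.Properties
open import Data.Nat.Tactic.RingSolver using (solve-∀)
open import Data.Product.Base using (_×_; _,_; ∃; proj₁; proj₂; map₂)
open import Data.Sum.Base using (_⊎_; inj₁; inj₂)
open import Data.Vec.Base as Vec using (Vec; []; _∷_; lookup; zipWith)
open import Data.Vec.Properties using (lookup-map; lookup-zipWith; lookup-replicate)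
open import Data.Vec.Relation.Unary.All.Properties using (lookup⁻)
open import Algebra.Properties.CommutativeMonoid.Sum +-0-commutativeMonoid using (sum; sum-remove; sum-cong-≗)
open import Function.Base using (_∘_)
open import Relation.Binary.Bundles using (DecTotalOrder)
import Relation.Binary.Construct.On as On
open import Relation.Binary.PropositionalEquality using (_≡_; _≢_; refl; sym; trans; cong; cong₂; subst; subst₂; module ≡-Reasoning)
open import Relation.Nullary.Decidable using (Dec; yes; no; True; toWitness; from-yes; from-no; _×-dec_; _⊎-dec_; _→-dec_)
open import Relation.Nullary.Negation using (¬_; contradiction)

-- Sums over initial segments of ℕ

∑ : ℕ → (ℕ → ℕ) → ℕ
∑ zero    f = 0
∑ (suc n) f = f n + ∑ n f

∑-cong : ∀ n {f g : ℕ → ℕ} → (∀ i → f i ≡ g i) → ∑ n f ≡ ∑ n g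
∑-cong zero    eq = refl
∑-cong (suc n) eq = cong₂ _+_ (eq n) (∑-cong n eq)

∑-0 : ∀ n {f : ℕ → ℕ} → (∀ {i} → i < n → f i ≡ 0) → ∑ n f ≡ 0
∑-0 zero    eq = refl
∑-0 (suc n) eq = cong₂ _+_ (eq ≤-refl) (∑-0 n (eq ∘ m≤n⇒m≤1+n))

∑-distrib-+ : ∀ n (f g : ℕ → ℕ) → ∑ n (λ i → f i + g i) ≡ ∑ n f + ∑ n g
∑-distrib-+ zero    f g = refl
∑-distrib-+ (suc n) f g = trans (cong (f n + g n +_) (∑-distrib-+ n f g))
                                (interchange (f n) (g n) (∑ n f) (∑ n g))
  where
  interchange : ∀ a b c d → a + b + (c + d) ≡ a + c + (b + d)
  interchange = solve-∀

∑-const : ∀ n c → ∑ n (λ _ → c) ≡ n * c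
∑-const zero    c = refl
∑-const (suc n) c = cong (c +_) (∑-const n c)

∑-<⇒∃ : ∀ n {f g : ℕ → ℕ} → ∑ n f < ∑ n g → ∃ λ i → f i < g i
∑-<⇒∃ (suc n) {f} {g} lt with f n <? g n
... | yes p = n , p
... | no ¬p = ∑-<⇒∃ n (≰⇒> λ ge → <⇒≱ lt (+-mono-≤ (≮⇒≥ ¬p) ge))

∑-mono-≤ : ∀ n {f g : ℕ → ℕ} → (∀ i → f i ≤ g i) → ∑ n f ≤ ∑ n g
∑-mono-≤ zero    le = z≤n
∑-mono-≤ (suc n) le = +-mono-≤ (le n) (∑-mono-≤ n le)

∑-mono-< : ∀ n {f g : ℕ → ℕ} → (∀ i → f i ≤ g i) → ∀ {k} → k < n → f k < g k → ∑ n f < ∑ n g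
∑-mono-< (suc n) le k<n lt with m≤n⇒m<n∨m≡n (≤-pred k<n)
... | inj₁ k<n′ = +-mono-≤-< (le n) (∑-mono-< n le k<n′ lt)
... | inj₂ refl = +-mono-<-≤ lt (∑-mono-≤ n le)

-- A nonzero last term forces all earlier ones to vanish, so the sum is a single term.
∑-atMostOne : ∀ n {f : ℕ → ℕ} {b} → (∀ i → f i ≤ b) →
              (∀ {i k} → i < k → k < n → f i ≡ 0 ⊎ f k ≡ 0) → ∑ n f ≤ b
∑-atMostOne zero    le disjoint = z≤n
∑-atMostOne (suc n) {f} {b} le disjoint with f n in eq
... | zero  = ∑-atMostOne n le λ i<k k<n → disjoint i<k (m≤n⇒m≤1+n k<n)
... | suc m = subst (_≤ b) (trans eq (sym (trans (cong (suc m +_) rest) (+-identityʳ _)))) (le n)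
  where
  rest : ∑ n f ≡ 0
  rest = ∑-0 n λ i<n → vanish (disjoint i<n ≤-refl)
    where
    vanish : ∀ {i} → f i ≡ 0 ⊎ f n ≡ 0 → f i ≡ 0
    vanish (inj₁ z) = z
    vanish (inj₂ z) = contradiction (trans (sym eq) z) λ ()

∑-suc : ∀ n (f : ℕ → ℕ) → ∑ n (f ∘ suc) + f 0 ≡ f n + ∑ n f
∑-suc zero    f = +-comm 0 (f 0)
∑-suc (suc n) f = trans (+-assoc (f (suc n)) _ (f 0)) (cong (f (suc n) +_) (∑-suc n f))

-- Moving the window by one place drops `f k` and gains `f (n + k)`, and periodicity makes these
-- equal. Adding `f k` to both sides avoids subtraction.
∑-shift : ∀ n (f : ℕ → ℕ) → (∀ i → f (i + n) ≡ f i) → ∀ k → ∑ n (λ i → f (i + k)) ≡ ∑ n f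
∑-shift n f periodic zero    = ∑-cong n λ i → cong f (+-identityʳ i)
∑-shift n f periodic (suc k) = +-cancelʳ-≡ (f k) _ _ (begin
  ∑ n (λ i → f (i + suc k)) + f k   ≡⟨ cong (_+ f k) (∑-cong n λ i → cong f (+-suc i k)) ⟩
  ∑ n (λ i → f (suc i + k)) + f k   ≡⟨ ∑-suc n (λ i → f (i + k)) ⟩
  f (n + k) + ∑ n (λ i → f (i + k)) ≡⟨ cong₂ _+_ (trans (cong f (+-comm n k)) (periodic k)) (∑-shift n f periodic k) ⟩
  f k + ∑ n f                       ≡⟨ +-comm (f k) _ ⟩
  ∑ n f + f k                       ∎)
  where open ≡-Reasoning

-- Points of ℕ² and the linear forms on them

Point : Set
Point = ℕ × ℕ

infixl 6 _⊕_
infixr 8 _⊙_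
infix  7 _·_

-- Opaque, so that unification recovers the points from equations between values of forms.
opaque

  _⊕_ : Point → Point → Point
  (a , b) ⊕ (c , d) = a + c , b + d

  _⊙_ : ℕ → Point → Point
  t ⊙ (a , b) = t * a , t * b

  _·_ : Point → Point → ℕ
  (a , b) · (c , d) = a * c + b * d

  ⊕-def : ∀ a b c d → (a , b) ⊕ (c , d) ≡ (a + c , b + d)
  ⊕-def a b c d = refl

  ·-def : ∀ a b c d → (a , b) · (c , d) ≡ a * c + b * d
  ·-def a b c d = refl

  ⊕-⊙-e₁ : ∀ a b n → (a , b) ⊕ n ⊙ (1 , 0) ≡ (a + n , b)
  ⊕-⊙-e₁ a b n = cong₂ _,_ (cong (a +_) (*-identityʳ n)) (trans (cong (b +_) (*-zeroʳ n)) (+-identityʳ b))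

  ⊕-⊙-e₂ : ∀ a b n → (a , b) ⊕ n ⊙ (0 , 1) ≡ (a , b + n)
  ⊕-⊙-e₂ a b n = cong₂ _,_ (trans (cong (a +_) (*-zeroʳ n)) (+-identityʳ a)) (cong (b +_) (*-identityʳ n))

  ⊙-distrib-⊕ : ∀ t p q → t ⊙ (p ⊕ q) ≡ t ⊙ p ⊕ t ⊙ q
  ⊙-distrib-⊕ t (a , b) (c , d) = cong₂ _,_ (*-distribˡ-+ t a c) (*-distribˡ-+ t b d)

  ·-distrib-⊕ : ∀ p q c → (p ⊕ q) · c ≡ p · c + q · c
  ·-distrib-⊕ (a , b) (a′ , b′) (c , d) = identity a b a′ b′ c d
    where
    identity : ∀ a b a′ b′ c d → (a + a′) * c + (b + b′) * d ≡ a * c + b * d + (a′ * c + b′ * d)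
    identity = solve-∀

  ·-⊙ : ∀ t p c → (t ⊙ p) · c ≡ t * (p · c)
  ·-⊙ t (a , b) (c , d) = identity t a b c d
    where
    identity : ∀ t a b c d → t * a * c + t * b * d ≡ t * (a * c + b * d)
    identity = solve-∀

-- Indicators of decidable propositions

n≡0⊎n>0 : ∀ n → n ≡ 0 ⊎ 0 < n
n≡0⊎n>0 zero    = inj₁ refl
n≡0⊎n>0 (suc n) = inj₂ z<s

ind : ∀ {P : Set} → Dec P → ℕ
ind (yes _) = 1
ind (no  _) = 0

ind-cong : ∀ {P Q : Set} (p? : Dec P) (q? : Dec Q) → (P → Q) → (Q → P) → ind p? ≡ ind q?
ind-cong (yes p) (yes q) to from = refl
ind-cong (yes p) (no ¬q) to from = contradiction (to p) ¬q
ind-cong (no ¬p) (yes q) to from = contradiction (from q) ¬p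
ind-cong (no ¬p) (no ¬q) to from = refl

ind-mono : ∀ {P Q : Set} (p? : Dec P) (q? : Dec Q) → (P → Q) → ind p? ≤ ind q?
ind-mono (yes p) (yes q) to = ≤-refl
ind-mono (yes p) (no ¬q) to = contradiction (to p) ¬q
ind-mono (no ¬p) q?      to = z≤n

ind-yes : ∀ {P : Set} (p? : Dec P) → P → ind p? ≡ 1
ind-yes (yes _) p = refl
ind-yes (no ¬p) p = contradiction p ¬p

ind-no : ∀ {P : Set} (p? : Dec P) → ¬ P → ind p? ≡ 0
ind-no (yes p) ¬p = contradiction p ¬p
ind-no (no _)  ¬p = refl

ind≤1 : ∀ {P : Set} (p? : Dec P) → ind p? ≤ 1
ind≤1 (yes _) = ≤-refl
ind≤1 (no  _) = z≤n

ind-≤ : ∀ {P : Set} (p? : Dec P) {n} → (P → 0 < n) → ind p? ≤ n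
ind-≤ (yes p) pos = pos p
ind-≤ (no _)  pos = z≤n

ind-pos : ∀ {P : Set} (p? : Dec P) → 0 < ind p? → P
ind-pos (yes p) _ = p

-- Congruences modulo N

∣a+k*m-resp-% : ∀ {m n o} a k .{{_ : NonZero o}} → m % o ≡ n % o → o ∣ a + k * m → o ∣ a + k * n
∣a+k*m-resp-% {m} {n} {o} a k eq o∣a+km = m%n≡0⇒n∣m (a + k * n) o (begin
  (a + k * n) % o                           ≡⟨ expand n ⟩
  (a % o + ((k % o) * (n % o)) % o) % o     ≡⟨ cong (λ r → (a % o + ((k % o) * r) % o) % o) eq ⟨
  (a % o + ((k % o) * (m % o)) % o) % o     ≡⟨ expand m ⟨
  (a + k * m) % o                           ≡⟨ n∣m⇒m%n≡0 (a + k * m) o o∣a+km ⟩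
  0                                         ∎)
  where
  open ≡-Reasoning
  expand : ∀ x → (a + k * x) % o ≡ (a % o + ((k % o) * (x % o)) % o) % o
  expand x = trans (%-distribˡ-+ a (k * x) o) (cong (λ r → (a % o + r) % o) (%-distribˡ-* k x o))

-- Bézout's identity modulo N, where the negative coefficient can be made positive.
bézout-mod : ∀ N .{{_ : NonZero N}} m n → ∃ λ x → ∃ λ y → (x * m + y * n) % N ≡ gcd m n % N
bézout-mod N@(suc N′) m n with Bézout.identity (gcd-GCD m n)
... | Bézout.+- x y eq = x , N′ * y ,
  trans (cong (_% N) (trans (cong (_+ N′ * y * n) (sym eq)) (lemma (gcd m n) y n N′)))
        ([m+kn]%n≡m%n (gcd m n) (y * n) N)
  where
  lemma : ∀ d y n N′ → d + y * n + N′ * y * n ≡ d + y * n * suc N′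
  lemma = solve-∀
... | Bézout.-+ x y eq = N′ * x , y ,
  trans (cong (_% N) (trans (cong (N′ * x * m +_) (sym eq)) (lemma (gcd m n) x m N′)))
        ([m+kn]%n≡m%n (gcd m n) (x * m) N)
  where
  lemma : ∀ d x m N′ → N′ * x * m + (d + x * m) ≡ d + x * m * suc N′
  lemma = solve-∀

-- The witness is `N / gcd N m`, the part of N that m leaves over. In `exponent` it divides every
-- value of every form, so content 1 turns it into a divisor of 1.
coprimeCofactor : ∀ N m .{{_ : NonZero N}} →
                  ∃ λ N′ → N′ ∣ N × (N′ ∣ 1 → N ∣ m) × (∀ {x} → N ∣ m * x → N′ ∣ x)
coprimeCofactor N m = N / d , m/n∣m d∣N , small , divisor
  where
  d = gcd N m
  d∣N = gcd[m,n]∣m N m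
  d∣m = gcd[m,n]∣n N m
  instance
    d≢0 : NonZero d
    d≢0 = ≢-nonZero λ d≡0 → ≢-nonZero⁻¹ N (0∣⇒≡0 (subst (_∣ N) d≡0 d∣N))
  small : N / d ∣ 1 → N ∣ m
  small N/d∣1 = subst (_∣ m) (trans (sym (*-identityˡ d)) (trans (cong (_* d) (sym (∣1⇒≡1 N/d∣1))) (m/n*n≡m d∣N))) d∣m
  divisor : ∀ {x} → N ∣ m * x → N / d ∣ x
  divisor {x} N∣mx = coprime-divisor (coprime-/gcd N m)
    (*-cancelʳ-∣ d (subst₂ _∣_ (sym (m/n*n≡m d∣N)) rearrange N∣mx))
    where
    swap : ∀ a b c → a * b * c ≡ a * c * b
    swap = solve-∀
    rearrange : m * x ≡ m / d * x * d
    rearrange = trans (cong (_* x) (sym (m/n*n≡m d∣m))) (swap (m / d) d x)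

-- Linear forms modulo N: gcds, orders and generators

module _ (N : ℕ) where

  pointGcd : Point → ℕ
  pointGcd (a , b) = gcd (gcd a b) N

  pointGcd∣N : ∀ c → pointGcd c ∣ N
  pointGcd∣N (a , b) = gcd[m,n]∣n (gcd a b) N

  pointGcd∣· : ∀ p c → pointGcd c ∣ p · c
  pointGcd∣· (x , y) (a , b) = subst (pointGcd (a , b) ∣_) (sym (·-def x y a b)) (∣m∣n⇒∣m+n
    (∣n⇒∣m*n x (∣-trans (gcd[m,n]∣m (gcd a b) N) (gcd[m,n]∣m a b)))
    (∣n⇒∣m*n y (∣-trans (gcd[m,n]∣m (gcd a b) N) (gcd[m,n]∣n a b))))

  -- The additive order of the form _· c modulo N.
  order : Point → ℕ
  order c = quotient (pointGcd∣N c)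

  N≡order*pointGcd : ∀ c → N ≡ order c * pointGcd c
  N≡order*pointGcd c = _∣_.equality (pointGcd∣N c)

  order∣N : ∀ c → order c ∣ N
  order∣N c = divides (pointGcd c) (trans (N≡order*pointGcd c) (*-comm (order c) _))

  order∣⇒N∣ : ∀ {m} c p → order c ∣ m → N ∣ m * (p · c)
  order∣⇒N∣ {m} c p o∣m = subst (_∣ m * (p · c)) (sym (N≡order*pointGcd c)) (*-pres-∣ o∣m (pointGcd∣· p c))

  module _ .{{_ : NonZero N}} where

    -- All values of the form are multiples of `pointGcd N c`, so the value at such a point
    -- generates them modulo N. For the special column, whose gcd is N / α, these points make up the
    -- coset `X`.
    IsGenerator : Point → Point → Set
    IsGenerator c p = (p · c) % N ≡ pointGcd c % N

    -- Bézout is applied twice: first to the two coefficients of the form, then to their gcd and N,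
    -- where the term `t * N` vanishes modulo N.
    generator : ∀ c → ∃ (IsGenerator c)
    generator c@(a , b) with bézout-mod N a b | bézout-mod N (gcd a b) N
    ... | x , y , eq | s , t , eq′ = s ⊙ (x , y) , (begin
      ((s ⊙ (x , y)) · c) % N               ≡⟨ cong (_% N) (·-⊙ s (x , y) c) ⟩
      (s * ((x , y) · c)) % N               ≡⟨ %-distribˡ-* s ((x , y) · c) N ⟩
      ((s % N) * (((x , y) · c) % N)) % N   ≡⟨ cong (λ r → ((s % N) * r) % N) (trans (cong (_% N) (·-def x y a b)) eq) ⟩
      ((s % N) * (gcd a b % N)) % N         ≡⟨ %-distribˡ-* s (gcd a b) N ⟨
      (s * gcd a b) % N                     ≡⟨ [m+kn]%n≡m%n (s * gcd a b) t N ⟨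
      (s * gcd a b + t * N) % N             ≡⟨ eq′ ⟩
      pointGcd c % N                        ∎)
      where open ≡-Reasoning

    -- Modulo N the value at p may be replaced by `pointGcd c`, which then cancels from
    -- `N ≡ order c * pointGcd c`.
    N∣⇒order∣ : ∀ {m} c {p} → IsGenerator c p → N ∣ m * (p · c) → order c ∣ m
    N∣⇒order∣ {m} c gen N∣mp = *-cancelʳ-∣ (pointGcd c) {{≢-nonZero gcd≢0}}
      (subst (_∣ m * pointGcd c) (N≡order*pointGcd c) (∣a+k*m-resp-% 0 m gen N∣mp))
      where
      gcd≢0 : pointGcd c ≢ 0
      gcd≢0 eq = ≢-nonZero⁻¹ N (0∣⇒≡0 (subst (_∣ N) eq (pointGcd∣N c)))

    order≢0 : ∀ c → NonZero (order c)
    order≢0 c = ≢-nonZero λ eq → ≢-nonZero⁻¹ N (trans (N≡order*pointGcd c) (cong (_* pointGcd c) eq))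

  -- The sum of a function over the box representing (ℤ/Nℤ)².
  ∑∑ : (Point → ℕ) → ℕ
  ∑∑ f = ∑ N λ a → ∑ N λ b → f (a , b)

  ∑∑-0 : ∑∑ (λ _ → 0) ≡ 0
  ∑∑-0 = ∑-0 N λ _ → ∑-0 N λ _ → refl

  ∑∑-distrib-+ : ∀ f g → ∑∑ (λ p → f p + g p) ≡ ∑∑ f + ∑∑ g
  ∑∑-distrib-+ f g = trans (∑-cong N λ a → ∑-distrib-+ N (λ b → f (a , b)) (λ b → g (a , b)))
                           (∑-distrib-+ N (λ a → ∑ N λ b → f (a , b)) (λ a → ∑ N λ b → g (a , b)))

  ∑∑-∑ : ∀ n (f : ℕ → Point → ℕ) → ∑∑ (λ p → ∑ n λ t → f t p) ≡ ∑ n (λ t → ∑∑ (f t))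
  ∑∑-∑ zero    f = ∑∑-0
  ∑∑-∑ (suc n) f = trans (∑∑-distrib-+ (f n) (λ p → ∑ n λ t → f t p)) (cong (∑∑ (f n) +_) (∑∑-∑ n f))

  ∑∑-<⇒∃ : ∀ {f g} → ∑∑ f < ∑∑ g → ∃ λ p → f p < g p
  ∑∑-<⇒∃ lt with ∑-<⇒∃ N lt
  ... | a , lt′ with ∑-<⇒∃ N lt′
  ...   | b , lt″ = (a , b) , lt″

  ∑∑-mono-≤ : ∀ {f g} → (∀ p → f p ≤ g p) → ∑∑ f ≤ ∑∑ g
  ∑∑-mono-≤ le = ∑-mono-≤ N λ a → ∑-mono-≤ N λ b → le (a , b)

  Periodic : (Point → ℕ) → Set
  Periodic f = ∀ p q → f (p ⊕ N ⊙ q) ≡ f p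

  ∑∑-shift : ∀ f → Periodic f → ∀ w → ∑∑ (λ p → f (p ⊕ w)) ≡ ∑∑ f
  ∑∑-shift f per (c , d) = trans
    (∑-cong N λ a → trans (∑-cong N λ b → cong f (⊕-def a b c d))
      (∑-shift N (λ b → f (a + c , b)) (λ b → trans (cong f (sym (⊕-⊙-e₂ _ b N))) (per _ _)) d))
    (∑-shift N (λ a → ∑ N λ b → f (a , b)) (λ a → ∑-cong N λ b → trans (cong f (sym (⊕-⊙-e₁ a b N))) (per _ _)) c)

  -- Translating the box by z moves z into its corner, so z need not lie in the box.
  ∑∑-mono-< : ∀ .{{_ : NonZero N}} {f g} → Periodic f → Periodic g → (∀ p → f p ≤ g p) →
              ∀ z → f z < g z → ∑∑ f < ∑∑ g
  ∑∑-mono-< {f} {g} perf perg le z@(a , b) lt = subst₂ _<_ (∑∑-shift f perf z) (∑∑-shift g perg z)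
    (∑-mono-< N (λ _ → ∑-mono-≤ N λ _ → le _) (>-nonZero⁻¹ N)
      (∑-mono-< N (λ _ → le _) (>-nonZero⁻¹ N) (subst (λ q → f q < g q) (sym (⊕-def 0 0 a b)) lt)))

-- Coverings by the zero sets of five linear forms

record Covering (N : ℕ) .{{_ : NonZero N}} : Set where
  field
    col     : Fin 5 → Point
    sumZero : ∀ p → N ∣ sum (λ i → p · col i)
    content : ∀ {c} → c ∣ N → (∀ p i → c ∣ p · col i) → c ∣ 1
    covers  : ∀ p → ∃ λ i → N ∣ p · col i

module _ {N : ℕ} .{{_ : NonZero N}} (C : Covering N) where

  open Covering C

  ord : Fin 5 → ℕ
  ord i = order N (col i)

  ∣sum : ∀ {n d} (f : Fin n → ℕ) → (∀ i → d ∣ f i) → d ∣ sum f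
  ∣sum {zero}  f d∣f = _ ∣0
  ∣sum {suc n} f d∣f = ∣m∣n⇒∣m+n (d∣f zero) (∣sum (f ∘ suc) (d∣f ∘ suc))

  -- Since the forms sum to zero, four of them determine the fifth, and together they have exponent N.
  abstract
    exponent : ∀ {m} k → (∀ i → i ≢ k → ord i ∣ m) → N ∣ m
    exponent {m} k ord∣m with coprimeCofactor N m
    ... | N′ , N′∣N , small , divisor = small (content N′∣N λ p i → divisor (kills p i))
      where
      kills≢ : ∀ p i → i ≢ k → N ∣ m * (p · col i)
      kills≢ p i i≢k = order∣⇒N∣ N (col i) p (ord∣m i i≢k)
      kills : ∀ p i → N ∣ m * (p · col i)
      kills p i with i ≟ᶠ k
      ... | no i≢k   = kills≢ p i i≢k
      ... | yes refl = subst (N ∣_) (·-⊙ m p (col k)) (∣m+n∣m⇒∣n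
        (subst (N ∣_) (trans (sum-remove {i = k} f) (+-comm (f k) _)) (sumZero (m ⊙ p)))
        (∣sum (λ i → f (punchIn k i)) λ i →
          subst (N ∣_) (sym (·-⊙ m p _)) (kills≢ p (punchIn k i) (punchInᵢ≢i k i))))
        where
        f : Fin 5 → ℕ
        f i = (m ⊙ p) · col i

  -- Densities of the zero sets inside the coset X

  module _ (j : Fin 5) where

    X : Point → Set
    X = IsGenerator N (col j)

    X? : ∀ p → Dec (X p)
    X? p = _ ≟ _

    Hit : Fin 5 → Point → Set
    Hit i p = X p × N ∣ p · col i

    Hit? : ∀ i p → Dec (Hit i p)
    Hit? i p = X? p ×-dec (N ∣? p · col i)

    hits : List (Fin 5) → Point → ℕ
    hits is p = sumᴸ (map (λ i → ind (Hit? i p)) is)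

    ∣X∣ : ℕ
    ∣X∣ = ∑∑ N (ind ∘ X?)

    ∣Hit∣ : Fin 5 → ℕ
    ∣Hit∣ i = ∑∑ N (ind ∘ Hit? i)

    module _ {w} (N∣w : N ∣ w · col j) where

      shift-% : ∀ p → ((p ⊕ w) · col j) % N ≡ (p · col j) % N
      shift-% p = trans (cong (_% N) (·-distrib-⊕ p w (col j))) (%-remove-+ʳ (p · col j) N∣w)

      X-shift⁺ : ∀ {p} → X p → X (p ⊕ w)
      X-shift⁺ {p} = trans (shift-% p)

      X-shift⁻ : ∀ {p} → X (p ⊕ w) → X p
      X-shift⁻ {p} = trans (sym (shift-% p))

    N∣N⊙ : ∀ p c → N ∣ (N ⊙ p) · c
    N∣N⊙ p c = subst (N ∣_) (sym (·-⊙ N p c)) (m∣m*n (p · c))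

    ∣-shift⁺ : ∀ {p w} c → N ∣ w · c → N ∣ p · c → N ∣ (p ⊕ w) · c
    ∣-shift⁺ {p} {w} c N∣w N∣p = subst (N ∣_) (sym (·-distrib-⊕ p w c)) (∣m∣n⇒∣m+n N∣p N∣w)

    ∣-shift⁻ : ∀ {p w} c → N ∣ w · c → N ∣ (p ⊕ w) · c → N ∣ p · c
    ∣-shift⁻ {p} {w} c N∣w N∣p+w =
      ∣m+n∣m⇒∣n (subst (N ∣_) (trans (·-distrib-⊕ p w c) (+-comm (p · c) (w · c))) N∣p+w) N∣w

    X-periodic : Periodic N (ind ∘ X?)
    X-periodic p q = ind-cong (X? (p ⊕ N ⊙ q)) (X? p) (X-shift⁻ (N∣N⊙ q (col j))) (X-shift⁺ (N∣N⊙ q (col j)))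

    Hit-periodic : ∀ i → Periodic N (ind ∘ Hit? i)
    Hit-periodic i p q = ind-cong (Hit? i (p ⊕ N ⊙ q)) (Hit? i p)
      (λ (x , d) → X-shift⁻ (N∣N⊙ q (col j)) x , ∣-shift⁻ (col i) (N∣N⊙ q (col i)) d)
      (λ (x , d) → X-shift⁺ (N∣N⊙ q (col j)) x , ∣-shift⁺ (col i) (N∣N⊙ q (col i)) d)

    hits-periodic : ∀ is → Periodic N (hits is)
    hits-periodic []       p q = refl
    hits-periodic (i ∷ is) p q = cong₂ _+_ (Hit-periodic i p q) (hits-periodic is p q)

    ∑∑-hits : ∀ is → ∑∑ N (hits is) ≡ sumᴸ (map ∣Hit∣ is)
    ∑∑-hits []       = ∑∑-0 N
    ∑∑-hits (i ∷ is) = trans (∑∑-distrib-+ N (ind ∘ Hit? i) (hits is)) (cong (∣Hit∣ i +_) (∑∑-hits is))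

    pos⇒∃ : ∀ {P : Point → Set} (P? : ∀ p → Dec (P p)) → 0 < ∑∑ N (ind ∘ P?) → ∃ P
    pos⇒∃ P? pos = map₂ (λ {p} → ind-pos (P? p)) (∑∑-<⇒∃ N (≤-<-trans (≤-reflexive (∑∑-0 N)) pos))

    ∣X∣>0 : 0 < ∣X∣
    ∣X∣>0 = ≤-<-trans z≤n (∑∑-mono-< N (λ _ _ → refl) X-periodic (λ _ → z≤n) (proj₁ z)
      (≤-reflexive (sym (ind-yes (X? (proj₁ z)) (proj₂ z)))))
      where
      z : ∃ X
      z = generator N (col j)

    module _ (i : Fin 5) {x y : Point} (hit : Hit i x) (gen : IsGenerator N (col i) y) where

      private
        k = quotient (pointGcd∣· N y (col j))
        -- Modulo `ord j` the factor `pred (ord j)` is -1. With M the gcd of column j, its value k *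
        -- M at y plus t times its value M at x gives k * `ord j` * M = k * N.
        t = k * pred (ord j)

      -- The generator y of column i, corrected by a multiple of the hit x so that column j
      -- vanishes. Translation by `step` therefore preserves X, while column i, being zero at x,
      -- still sees y.
      step : Point
      step = y ⊕ t ⊙ x

      N∣step·j : N ∣ step · col j
      N∣step·j = subst (N ∣_) (sym (trans (·-distrib-⊕ y (t ⊙ x) (col j)) (cong (y · col j +_) (·-⊙ t x (col j)))))
        (∣a+k*m-resp-% (y · col j) t (sym (proj₁ hit)) (divides k (begin
          y · col j + t * M          ≡⟨ cong (_+ t * M) (_∣_.equality (pointGcd∣· N y (col j))) ⟩
          k * M + t * M              ≡⟨ factor k M (pred (ord j)) ⟩
          k * (suc (pred (ord j)) * M) ≡⟨ cong (λ o → k * (o * M)) (suc-pred (ord j) {{order≢0 N (col j)}}) ⟩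
          k * (ord j * M)            ≡⟨ cong (k *_) (N≡order*pointGcd N (col j)) ⟨
          k * N                      ∎)))
        where
        open ≡-Reasoning
        M = pointGcd N (col j)
        factor : ∀ k M o → k * M + k * o * M ≡ k * (suc o * M)
        factor = solve-∀

      -- Column i vanishes at x, so modulo N its value at `step` is the generating value at y.
      N∣step⇒ord∣ : ∀ {m} → N ∣ m * (step · col i) → ord i ∣ m
      N∣step⇒ord∣ {m} N∣ = N∣⇒order∣ N (col i) gen (subst (N ∣_) (·-⊙ m y (col i))
        (∣-shift⁻ (col i) N∣tail (subst (N ∣_) (trans (sym (·-⊙ m step (col i))) (cong (_· col i) (⊙-distrib-⊕ m y (t ⊙ x)))) N∣)))
        where
        N∣tail : N ∣ (m ⊙ t ⊙ x) · col i
        N∣tail = subst (N ∣_) (sym (trans (·-⊙ m (t ⊙ x) (col i)) (cong (m *_) (·-⊙ t x (col i)))))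
          (∣n⇒∣m*n m (∣n⇒∣m*n t (proj₂ hit)))

      -- The translates of the zero set of column i inside X by 0, step, …, (ord i - 1) step are disjoint.
      translates : ∀ p → ∑ (ord i) (λ s → ind (Hit? i (p ⊕ s ⊙ step))) ≤ ind (X? p)
      translates p = ∑-atMostOne (ord i)
        (λ s → ind-mono (Hit? i (p ⊕ s ⊙ step)) (X? p) (X-shift⁻ (N∣s⊙step s) ∘ proj₁)) disjoint
        where
        N∣s⊙step : ∀ s → N ∣ (s ⊙ step) · col j
        N∣s⊙step s = subst (N ∣_) (sym (·-⊙ s step (col j))) (∣n⇒∣m*n s N∣step·j)
        value : ∀ s → (p ⊕ s ⊙ step) · col i ≡ p · col i + s * (step · col i)
        value s = trans (·-distrib-⊕ p (s ⊙ step) (col i)) (cong (p · col i +_) (·-⊙ s step (col i)))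
        difference : ∀ {s u} → s < u → N ∣ (p ⊕ s ⊙ step) · col i → N ∣ (p ⊕ u ⊙ step) · col i → ord i ∣ u ∸ s
        difference {s} {u} s<u N∣s N∣u = N∣step⇒ord∣ (∣m+n∣m⇒∣n (subst (N ∣_) split N∣u) N∣s)
          where
          v = step · col i
          open ≡-Reasoning
          split : (p ⊕ u ⊙ step) · col i ≡ (p ⊕ s ⊙ step) · col i + (u ∸ s) * v
          split = begin
            (p ⊕ u ⊙ step) · col i               ≡⟨ value u ⟩
            p · col i + u * v                    ≡⟨ cong (λ r → p · col i + r * v) (m+[n∸m]≡n (<⇒≤ s<u)) ⟨
            p · col i + (s + (u ∸ s)) * v        ≡⟨ cong (p · col i +_) (*-distribʳ-+ v s (u ∸ s)) ⟩
            p · col i + (s * v + (u ∸ s) * v)    ≡⟨ +-assoc (p · col i) (s * v) _ ⟨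
            p · col i + s * v + (u ∸ s) * v      ≡⟨ cong (_+ (u ∸ s) * v) (value s) ⟨
            (p ⊕ s ⊙ step) · col i + (u ∸ s) * v ∎
        disjoint : ∀ {s u} → s < u → u < ord i →
                   ind (Hit? i (p ⊕ s ⊙ step)) ≡ 0 ⊎ ind (Hit? i (p ⊕ u ⊙ step)) ≡ 0
        disjoint {s} {u} s<u u<o with Hit? i (p ⊕ s ⊙ step)
        ... | no _          = inj₁ refl
        ... | yes (_ , N∣s) = inj₂ (ind-no (Hit? i (p ⊕ u ⊙ step)) λ (_ , N∣u) →
          -- A common point would make `u ∸ s` a positive multiple of `ord i` below `ord i`.
          <⇒≱ (≤-<-trans (m∸n≤m u s) u<o) (∣⇒≤ {{>-nonZero (m<n⇒0<n∸m s<u)}} (difference s<u N∣s N∣u)))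

      -- By periodicity every translate has as many points in the box as the zero set itself, so
      -- summing `translates` over the box counts that set `ord i` times.
      ord*∣Hit∣≤∣X∣′ : ord i * ∣Hit∣ i ≤ ∣X∣
      ord*∣Hit∣≤∣X∣′ = begin
        ord i * ∣Hit∣ i                                               ≡⟨ ∑-const (ord i) (∣Hit∣ i) ⟨
        ∑ (ord i) (λ _ → ∣Hit∣ i)                                     ≡⟨ ∑-cong (ord i) (λ s → ∑∑-shift N (ind ∘ Hit? i) (Hit-periodic i) (s ⊙ step)) ⟨
        ∑ (ord i) (λ s → ∑∑ N λ p → ind (Hit? i (p ⊕ s ⊙ step)))      ≡⟨ ∑∑-∑ N (ord i) (λ s p → ind (Hit? i (p ⊕ s ⊙ step))) ⟨
        ∑∑ N (λ p → ∑ (ord i) (λ s → ind (Hit? i (p ⊕ s ⊙ step))))    ≤⟨ ∑∑-mono-≤ N translates ⟩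
        ∣X∣                                                           ∎
        where open ≤-Reasoning

    -- Building `step` takes a point of X on the zero set; without one the left side is 0.
    ord*∣Hit∣≤∣X∣ : ∀ i → ord i * ∣Hit∣ i ≤ ∣X∣
    ord*∣Hit∣≤∣X∣ i = byCases (n≡0⊎n>0 (∣Hit∣ i))
      where
      byCases : ∣Hit∣ i ≡ 0 ⊎ 0 < ∣Hit∣ i → ord i * ∣Hit∣ i ≤ ∣X∣
      byCases (inj₁ ≡0) = ≤-trans (≤-reflexive (trans (cong (ord i *_) ≡0) (*-zeroʳ (ord i)))) z≤n
      byCases (inj₂ >0) = ord*∣Hit∣≤∣X∣′ i (proj₂ (pos⇒∃ (Hit? i) >0)) (proj₂ (generator N (col i)))

    -- Density bounds over a common denominator, without fractions: the condition says 1 / `ord i` ≤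
    -- q / L.
    Weighted : ℕ → List (Fin 5) → List ℕ → Set
    Weighted L = Pointwise λ i q → L ≤ q * ord i

    weighted-≤ : ∀ {L is qs} → Weighted L is qs → L * ∑∑ N (hits is) ≤ sumᴸ qs * ∣X∣
    weighted-≤ {L} {is} ws = subst (λ h → L * h ≤ _) (sym (∑∑-hits is)) (bound ws)
      where
      open ≤-Reasoning
      bound : ∀ {is qs} → Weighted L is qs → L * sumᴸ (map ∣Hit∣ is) ≤ sumᴸ qs * ∣X∣
      bound []                          = ≤-reflexive (*-zeroʳ L)
      bound (_∷_ {i} {q} {is} {qs} w ws) = begin
        L * (∣Hit∣ i + sumᴸ (map ∣Hit∣ is))     ≡⟨ *-distribˡ-+ L (∣Hit∣ i) _ ⟩
        L * ∣Hit∣ i + L * sumᴸ (map ∣Hit∣ is)   ≤⟨ +-mono-≤ (*-monoˡ-≤ (∣Hit∣ i) w) (bound ws) ⟩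
        q * ord i * ∣Hit∣ i + sumᴸ qs * ∣X∣     ≡⟨ cong (_+ sumᴸ qs * ∣X∣) (*-assoc q (ord i) (∣Hit∣ i)) ⟩
        q * (ord i * ∣Hit∣ i) + sumᴸ qs * ∣X∣   ≤⟨ +-monoˡ-≤ _ (*-monoʳ-≤ q (ord*∣Hit∣≤∣X∣ i)) ⟩
        q * ∣X∣ + sumᴸ qs * ∣X∣                 ≡⟨ *-distribʳ-+ ∣X∣ q (sumᴸ qs) ⟨
        (q + sumᴸ qs) * ∣X∣                     ∎

    hits≡0 : ∀ is {p} → X p → hits is p ≡ 0 → All (λ i → ¬ N ∣ p · col i) is
    hits≡0 []       Xp eq = []
    hits≡0 (i ∷ is) {p} Xp eq =
      (λ N∣ → contradiction (trans (sym (ind-yes (Hit? i p) (Xp , N∣))) (m+n≡0⇒m≡0 _ eq)) λ ()) ∷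
      hits≡0 is Xp (m+n≡0⇒n≡0 (ind (Hit? i p)) eq)

    abstract
      -- The densities q / L add up to less than 1, so somewhere the number of hits falls below the
      -- indicator of X. That happens only at a point of X without hits.
      avoids : ∀ {L is qs} → Weighted L is qs → sumᴸ qs < L →
               ∃ λ p → X p × All (λ i → ¬ N ∣ p · col i) is
      avoids {L} {is} {qs} ws lt = miss (∑∑-<⇒∃ N (*-cancelˡ-< L _ _
        (≤-<-trans (weighted-≤ ws) (*-monoˡ-< ∣X∣ {{>-nonZero ∣X∣>0}} lt))))
        where
        miss : (∃ λ p → hits is p < ind (X? p)) → ∃ λ p → X p × All (λ i → ¬ N ∣ p · col i) is
        miss (p , hits<X) = p , Xp , hits≡0 is Xp (n<1⇒n≡0 (<-≤-trans hits<X (ind≤1 (X? p))))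
          where
          Xp : X p
          Xp = ind-pos (X? p) (≤-<-trans z≤n hits<X)

    hit⇒0<hits : ∀ {is p} → X p → Any (λ i → N ∣ p · col i) is → 0 < hits is p
    hit⇒0<hits {i ∷ is} {p} Xp (here N∣) = subst (λ h → 0 < h + hits is p) (sym (ind-yes (Hit? i p) (Xp , N∣))) z<s
    hit⇒0<hits {i ∷ is} {p} Xp (there a) = <-≤-trans (hit⇒0<hits Xp a) (m≤n+m _ (ind (Hit? i p)))

    -- Hits counted with multiplicity exceed ∣X∣ as soon as one point of X is hit twice.
    abstract
      noOverlap : ∀ {L is qs} → Weighted L is qs → sumᴸ qs ≤ L → .{{_ : NonZero L}} →
                  (∀ p → X p → Any (λ i → N ∣ p · col i) is) → ∀ z → hits is z ≤ 1
      noOverlap {L} {is} {qs} ws le covered z = ≮⇒≥ λ 1<hits → <⇒≱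
        (∑∑-mono-< N X-periodic (hits-periodic is) X≤hits z (≤-<-trans (ind≤1 (X? z)) 1<hits))
        (*-cancelˡ-≤ L (≤-trans (weighted-≤ ws) (*-monoˡ-≤ ∣X∣ le)))
        where
        X≤hits : ∀ p → ind (X? p) ≤ hits is p
        X≤hits p = ind-≤ (X? p) λ Xp → hit⇒0<hits Xp (covered p Xp)

    -- A zero at a generator would make `ord j` divide 1.
    X⇒∤ : ∀ {p} → 2 ≤ ord j → X p → ¬ N ∣ p · col j
    X⇒∤ {p} 2≤ Xp N∣ = <⇒≱ 2≤ (∣⇒≤ (N∣⇒order∣ N (col j) Xp (subst (N ∣_) (sym (*-identityˡ (p · col j))) N∣)))

  -- A point behaving like v for forms of order 3 and like u for forms of order 4:
  -- 4 and 9 are the idempotents of ℤ/12ℤ.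
  glue : Point → Point → Point
  glue v u = 4 ⊙ v ⊕ 9 ⊙ u

  glue-· : ∀ v u c → glue v u · c ≡ 4 * (v · c) + 9 * (u · c)
  glue-· v u c = trans (·-distrib-⊕ (4 ⊙ v) (9 ⊙ u) c) (cong₂ _+_ (·-⊙ 4 v c) (·-⊙ 9 u c))

  module _ (v u : Point) where

    ord∣3⇒glue∣ : ∀ i → ord i ∣ 3 → N ∣ v · col i → N ∣ glue v u · col i
    ord∣3⇒glue∣ i o∣3 N∣v = subst (N ∣_) (sym (glue-· v u (col i)))
      (∣m∣n⇒∣m+n (∣n⇒∣m*n 4 N∣v) (order∣⇒N∣ N (col i) u (∣-trans o∣3 (divides 3 refl))))

    ord∣3⇒∣glue : ∀ i → ord i ∣ 3 → N ∣ glue v u · col i → N ∣ v · col i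
    ord∣3⇒∣glue i o∣3 N∣z = ∣m+n∣m⇒∣n (subst (N ∣_) (trans (glue-· v u (col i)) (regroup (v · col i) (u · col i))) N∣z)
      (∣m∣n⇒∣m+n (order∣⇒N∣ N (col i) v o∣3) (order∣⇒N∣ N (col i) u (∣-trans o∣3 (divides 3 refl))))
      where
      regroup : ∀ x y → 4 * x + 9 * y ≡ 3 * x + 9 * y + x
      regroup = solve-∀

    private
      regroup₄ : ∀ x y → 4 * x + 9 * y ≡ 4 * x + 8 * y + y
      regroup₄ = solve-∀

      ord∣4⇒N∣ : ∀ i → ord i ∣ 4 → N ∣ 4 * (v · col i) + 8 * (u · col i)
      ord∣4⇒N∣ i o∣4 = ∣m∣n⇒∣m+n (order∣⇒N∣ N (col i) v o∣4) (order∣⇒N∣ N (col i) u (∣-trans o∣4 (divides 2 refl)))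

      glue-·₄ : ∀ i → glue v u · col i ≡ 4 * (v · col i) + 8 * (u · col i) + u · col i
      glue-·₄ i = trans (glue-· v u (col i)) (regroup₄ (v · col i) (u · col i))

    ord∣4⇒glue∣ : ∀ i → ord i ∣ 4 → N ∣ u · col i → N ∣ glue v u · col i
    ord∣4⇒glue∣ i o∣4 N∣u = subst (N ∣_) (sym (glue-·₄ i)) (∣m∣n⇒∣m+n (ord∣4⇒N∣ i o∣4) N∣u)

    ord∣4⇒∣glue : ∀ i → ord i ∣ 4 → N ∣ glue v u · col i → N ∣ u · col i
    ord∣4⇒∣glue i o∣4 N∣z = ∣m+n∣m⇒∣n (subst (N ∣_) (glue-·₄ i) N∣z) (ord∣4⇒N∣ i o∣4)

    -- Membership in X is a condition on column j alone, whose order divides 4, so it is inherited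
    -- from u.
    glue-X : ∀ j → ord j ∣ 4 → X j u → X j (glue v u)
    glue-X j o∣4 Xu = trans (trans (cong (_% N) (glue-·₄ j)) (%-remove-+ˡ (u · col j) (ord∣4⇒N∣ j o∣4))) Xu

-- Case analysis over the orders of the columns

≡⇒∣ : ∀ {n k m} → n ≡ k → {True (k ∣? m)} → n ∣ m
≡⇒∣ refl {k∣m} = toWitness k∣m

∣⇒≱9 : ∀ {N m} .{{_ : NonZero m}} → N ∣ m → {True (m <? 9)} → ¬ 9 ≤ N
∣⇒≱9 N∣m {m<9} 9≤N = <⇒≱ (toWitness m<9) (≤-trans 9≤N (∣⇒≤ N∣m))

≤⇒≡⊎< : ∀ {m n} → m ≤ n → n ≡ m ⊎ suc m ≤ n
≤⇒≡⊎< m≤n with m≤n⇒m<n∨m≡n m≤n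
... | inj₁ m<n  = inj₂ m<n
... | inj₂ refl = inj₁ refl

abstract
  4≤n∣12 : ∀ {n} → 4 ≤ n → n ∣ 12 → n ≡ 4 ⊎ n ≡ 6 ⊎ n ≡ 12
  4≤n∣12 4≤n n∣12 = from-yes (allUpTo? (λ n → (4 ≤? n) →-dec ((n ∣? 12) →-dec ((n ≟ 4) ⊎-dec ((n ≟ 6) ⊎-dec (n ≟ 12))))) 13) (s≤s (∣⇒≤ n∣12)) 4≤n n∣12

module _ {N : ℕ} .{{_ : NonZero N}} (9≤N : 9 ≤ N) (C : Covering N) (j : Fin 5) (2≤ordj : 2 ≤ ord C j)
         (a b c d : Fin 5) (complete : ∀ i → i ∈ j ∷ a ∷ b ∷ c ∷ d ∷ []) where

  open Covering C

  private
    o : Fin 5 → ℕ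
    o = ord C

    rest : List (Fin 5)
    rest = a ∷ b ∷ c ∷ d ∷ []

    Zero : Point → Fin 5 → Set
    Zero p i = N ∣ p · col i

    ≡⇒≥ : ∀ {m n : ℕ} → m ≡ n → n ≤ m
    ≡⇒≥ = ≤-reflexive ∘ sym

  infixr 5 _≤∷_
  -- A numerical lower bound k stands in for the order, so that the weight condition is settled by
  -- computation.
  _≤∷_ : ∀ {L i is k q qs} → k ≤ o i → Weighted C j L is qs → {True (L ≤? q * k)} →
         Weighted C j L (i ∷ is) (q ∷ qs)
  _≤∷_ {q = q} k≤o ws {L≤qk} = ≤-trans (toWitness L≤qk) (*-monoʳ-≤ q k≤o) ∷ ws

  -- The left alternative marks the one column that `exponent` leaves out.
  exponentOfList : ∀ {m} k → All (λ i → i ≡ k ⊎ o i ∣ m) (j ∷ rest) → N ∣ m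
  exponentOfList {m} k all = exponent C k λ i i≢k → resolve i≢k (All.lookup all (complete i))
    where
    resolve : ∀ {i} → i ≢ k → i ≡ k ⊎ o i ∣ m → o i ∣ m
    resolve i≢k (inj₁ i≡k) = contradiction i≡k i≢k
    resolve i≢k (inj₂ o∣m) = o∣m

  coveredByRest : ∀ p → X C j p → Any (Zero p) rest
  coveredByRest p Xp = Any.tail (X⇒∤ C j 2≤ordj Xp) (lose (complete (proj₁ (covers p))) (proj₂ (covers p)))

  sparse : ∀ {L qs} → Weighted C j L rest qs → sumᴸ qs < L → ⊥
  sparse ws lt with avoids C j ws lt
  ... | p , Xp , none = All¬⇒¬Any none (coveredByRest p Xp)

  -- The columns in `is` have total density below 1 and miss a point of X, which is left for column
  -- i to cover.
  mustHit : ∀ {L is qs i} → Weighted C j L is qs → sumᴸ qs < L →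
            (∀ {P : Fin 5 → Set} → Any P rest → P i ⊎ Any P is) → ∃ (Hit C j i)
  mustHit {i = i} ws lt remove with avoids C j ws lt
  ... | p , Xp , none = p , Xp , resolve (remove (coveredByRest p Xp))
    where
    resolve : Zero p i ⊎ Any (Zero p) _ → Zero p i
    resolve (inj₁ N∣) = N∣
    resolve (inj₂ an) = contradiction an (All¬⇒¬Any none)

  remove₁ : ∀ {P : Fin 5 → Set} → Any P rest → P a ⊎ Any P (b ∷ c ∷ d ∷ [])
  remove₁ (here x)  = inj₁ x
  remove₁ (there x) = inj₂ x

  remove₂ : ∀ {P : Fin 5 → Set} → Any P rest → P b ⊎ Any P (a ∷ c ∷ d ∷ [])
  remove₂ (here x)          = inj₂ (here x)
  remove₂ (there (here x))  = inj₁ x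
  remove₂ (there (there x)) = inj₂ (there x)

  remove₃ : ∀ {P : Fin 5 → Set} → Any P rest → P c ⊎ Any P (a ∷ b ∷ d ∷ [])
  remove₃ (here x)                  = inj₂ (here x)
  remove₃ (there (here x))          = inj₂ (there (here x))
  remove₃ (there (there (here x)))  = inj₁ x
  remove₃ (there (there (there x))) = inj₂ (there (there x))

  -- The zero sets in X of a form of order 3 and one of order 4 meet, so they cannot be part of a partition of X.
  notTight : ∀ {L qs} .{{_ : NonZero L}} → Weighted C j L rest qs → sumᴸ qs ≤ L → o j ∣ 4 → o a ∣ 3 →
             ∀ {i} → i ∈ b ∷ c ∷ d ∷ [] → o i ∣ 4 → ∃ (Hit C j a) → ∃ (Hit C j i) → ⊥
  notTight ws le oj∣4 oa∣3 {i} i∈ oi∣4 (v , _ , N∣v) (u , Xu , N∣u) = <⇒≱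
    -- Column a takes its zero at z from v and column i takes its zero from u, so z is hit twice.
    (+-mono-≤ (≤-reflexive (sym (ind-yes (Hit? C j a z) (Xz , ord∣3⇒glue∣ C v u a oa∣3 N∣v))))
              (hit⇒0<hits C j Xz (lose i∈ (ord∣4⇒glue∣ C v u i oi∣4 N∣u))))
    (noOverlap C j ws le coveredByRest z)
    where
    z = glue C v u
    Xz : X C j z
    Xz = glue-X C v u j oj∣4 Xu

  -- Two densities of at most 1/3 leave a point v of X free, two of at most 1/4 leave a point u. The
  -- glued point lies in X and escapes all four zero sets.
  orders3344 : o j ∣ 4 → o a ≡ 3 → o b ≡ 3 → o c ≡ 4 → o d ≡ 4 → ⊥
  orders3344 oj∣4 a3 b3 c4 d4 = clash
    (avoids C j {L = 3} {qs = 1 ∷ 1 ∷ []} (≡⇒≥ a3 ≤∷ ≡⇒≥ b3 ≤∷ []) ≤-refl)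
    (avoids C j {L = 4} {qs = 1 ∷ 1 ∷ []} (≡⇒≥ c4 ≤∷ ≡⇒≥ d4 ≤∷ []) (from-yes (2 <? 4)))
    where
    clash : (∃ λ v → X C j v × All (λ i → ¬ Zero v i) (a ∷ b ∷ [])) →
            (∃ λ u → X C j u × All (λ i → ¬ Zero u i) (c ∷ d ∷ [])) → ⊥
    clash (v , _ , va ∷ vb ∷ []) (u , Xu , uc ∷ ud ∷ []) = All¬⇒¬Any
      ( va ∘ ord∣3⇒∣glue C v u a (≡⇒∣ a3) ∷ vb ∘ ord∣3⇒∣glue C v u b (≡⇒∣ b3)
      ∷ uc ∘ ord∣4⇒∣glue C v u c (≡⇒∣ c4) ∷ ud ∘ ord∣4⇒∣glue C v u d (≡⇒∣ d4) ∷ [])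
      (coveredByRest (glue C v u) (glue-X C v u j oj∣4 Xu))

  infix 9 _!

  _! : ∀ {i k m} {n} → o i ≡ n → {True (n ∣? m)} → i ≡ k ⊎ o i ∣ m
  _! eq {t} = inj₂ (≡⇒∣ eq {t})

  -- If `o c` ≥ 5, the densities total at most 59/60. Otherwise b and c have order 4, and leaving
  -- out d gives N ∣ 12, hence `o d` ∣ 12. Order 4 for d leads to N ∣ 4, order 12 to total density
  -- 11/12, and order 6 to total exactly 1, where overlapping zero sets decide.
  orders34 : o j ≡ 2 → o a ≡ 3 → 4 ≤ o b → o b ≤ o c → o c ≤ o d → ⊥
  orders34 j2 a3 4≤b b≤c c≤d with ≤⇒≡⊎< (≤-trans 4≤b b≤c)
  ... | inj₂ 5≤c = sparse {60} {20 ∷ 15 ∷ 12 ∷ 12 ∷ []}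
    (≡⇒≥ a3 ≤∷ 4≤b ≤∷ 5≤c ≤∷ ≤-trans 5≤c c≤d ≤∷ []) ≤-refl
  ... | inj₁ c4 = c≡4 (≤-antisym (≤-trans b≤c (≤-reflexive c4)) 4≤b) (≤-trans (≡⇒≥ c4) c≤d)
    where
    c≡4 : o b ≡ 4 → 4 ≤ o d → ⊥
    c≡4 b4 4≤d with 4≤n∣12 4≤d (∣-trans (order∣N N (col d)) (exponentOfList d (j2 ! ∷ a3 ! ∷ b4 ! ∷ c4 ! ∷ inj₁ refl ∷ [])))
    ... | inj₁ d4          = ∣⇒≱9 (exponentOfList {4} a (j2 ! ∷ inj₁ refl ∷ b4 ! ∷ c4 ! ∷ d4 ! ∷ [])) 9≤N
    ... | inj₂ (inj₁ d6)   = notTight {12} {4 ∷ 3 ∷ 3 ∷ 2 ∷ []}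
      (≡⇒≥ a3 ≤∷ ≡⇒≥ b4 ≤∷ ≡⇒≥ c4 ≤∷ ≡⇒≥ d6 ≤∷ []) ≤-refl
      (≡⇒∣ j2) (≡⇒∣ a3) (here refl) (≡⇒∣ b4)
      (mustHit {12} {qs = 3 ∷ 3 ∷ 2 ∷ []} (≡⇒≥ b4 ≤∷ ≡⇒≥ c4 ≤∷ ≡⇒≥ d6 ≤∷ []) (from-yes (8 <? 12)) remove₁)
      (mustHit {12} {qs = 4 ∷ 3 ∷ 2 ∷ []} (≡⇒≥ a3 ≤∷ ≡⇒≥ c4 ≤∷ ≡⇒≥ d6 ≤∷ []) (from-yes (9 <? 12)) remove₂)
    ... | inj₂ (inj₂ d12)  = sparse {12} {4 ∷ 3 ∷ 3 ∷ 1 ∷ []}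
      (≡⇒≥ a3 ≤∷ ≡⇒≥ b4 ≤∷ ≡⇒≥ c4 ≤∷ ≡⇒≥ d12 ≤∷ []) ≤-refl

  -- Leaving out d again gives `o d` ∣ 12. Order 4 is settled by gluing, order 6 yields N ∣ 6 when c
  -- is left out, and order 12 makes the densities total exactly 1.
  orders334 : o j ≡ 2 → o a ≡ 3 → o b ≡ 3 → o c ≡ 4 → 4 ≤ o d → ⊥
  orders334 j2 a3 b3 c4 4≤d with 4≤n∣12 4≤d (∣-trans (order∣N N (col d)) (exponentOfList d (j2 ! ∷ a3 ! ∷ b3 ! ∷ c4 ! ∷ inj₁ refl ∷ [])))
  ... | inj₁ d4          = orders3344 (≡⇒∣ j2) a3 b3 c4 d4
  ... | inj₂ (inj₁ d6)   = ∣⇒≱9 (exponentOfList {6} c (j2 ! ∷ a3 ! ∷ b3 ! ∷ inj₁ refl ∷ d6 ! ∷ [])) 9≤N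
  ... | inj₂ (inj₂ d12)  = notTight {12} {4 ∷ 4 ∷ 3 ∷ 1 ∷ []}
    (≡⇒≥ a3 ≤∷ ≡⇒≥ b3 ≤∷ ≡⇒≥ c4 ≤∷ ≡⇒≥ d12 ≤∷ []) ≤-refl
    (≡⇒∣ j2) (≡⇒∣ a3) (there (here refl)) (≡⇒∣ c4)
    (mustHit {12} {qs = 4 ∷ 3 ∷ 1 ∷ []} (≡⇒≥ b3 ≤∷ ≡⇒≥ c4 ≤∷ ≡⇒≥ d12 ≤∷ []) (from-yes (8 <? 12)) remove₁)
    (mustHit {12} {qs = 4 ∷ 4 ∷ 1 ∷ []} (≡⇒≥ a3 ≤∷ ≡⇒≥ b3 ≤∷ ≡⇒≥ d12 ≤∷ []) (from-yes (9 <? 12)) remove₃)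

  -- Order 5 for d gives N ∣ 15 although 2 ∣ N, order 6 gives N ∣ 6, and order 7 gives N ∣ 30
  -- although 7 ∣ N. From 8 on the densities total at most 119/120.
  orders335 : o j ≡ 2 → o a ≡ 3 → o b ≡ 3 → o c ≡ 5 → 5 ≤ o d → ⊥
  orders335 j2 a3 b3 c5 5≤d with ≤⇒≡⊎< 5≤d
  ... | inj₁ d5 = from-no (2 ∣? 15) (∣-trans (subst (_∣ N) j2 (order∣N N (col j)))
                    (exponentOfList j (inj₁ refl ∷ a3 ! ∷ b3 ! ∷ c5 ! ∷ d5 ! ∷ [])))
  ... | inj₂ 6≤d with ≤⇒≡⊎< 6≤d
  ...   | inj₁ d6 = ∣⇒≱9 (exponentOfList {6} c (j2 ! ∷ a3 ! ∷ b3 ! ∷ inj₁ refl ∷ d6 ! ∷ [])) 9≤N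
  ...   | inj₂ 7≤d with ≤⇒≡⊎< 7≤d
  ...     | inj₁ d7 = from-no (7 ∣? 30) (∣-trans (subst (_∣ N) d7 (order∣N N (col d)))
                        (exponentOfList d (j2 ! ∷ a3 ! ∷ b3 ! ∷ c5 ! ∷ inj₁ refl ∷ [])))
  ...     | inj₂ 8≤d = sparse {120} {40 ∷ 40 ∷ 24 ∷ 15 ∷ []}
    (≡⇒≥ a3 ≤∷ ≡⇒≥ b3 ≤∷ ≡⇒≥ c5 ≤∷ 8≤d ≤∷ []) ≤-refl

  -- Orders 3 and 6 for c give N ∣ 6 when d is left out; from 7 on the densities total at most
  -- 20/21. Orders 4 and 5 are treated separately.
  orders33 : o j ≡ 2 → o a ≡ 3 → o b ≡ 3 → 3 ≤ o c → o c ≤ o d → ⊥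
  orders33 j2 a3 b3 3≤c c≤d with ≤⇒≡⊎< 3≤c
  ... | inj₁ c3 = ∣⇒≱9 (exponentOfList {6} d (j2 ! ∷ a3 ! ∷ b3 ! ∷ c3 ! ∷ inj₁ refl ∷ [])) 9≤N
  ... | inj₂ 4≤c with ≤⇒≡⊎< 4≤c
  ...   | inj₁ c4 = orders334 j2 a3 b3 c4 (≤-trans 4≤c c≤d)
  ...   | inj₂ 5≤c with ≤⇒≡⊎< 5≤c
  ...     | inj₁ c5 = orders335 j2 a3 b3 c5 (≤-trans 5≤c c≤d)
  ...     | inj₂ 6≤c with ≤⇒≡⊎< 6≤c
  ...       | inj₁ c6 = ∣⇒≱9 (exponentOfList {6} d (j2 ! ∷ a3 ! ∷ b3 ! ∷ c6 ! ∷ inj₁ refl ∷ [])) 9≤N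
  ...       | inj₂ 7≤c = sparse {21} {7 ∷ 7 ∷ 3 ∷ 3 ∷ []}
    (≡⇒≥ a3 ≤∷ ≡⇒≥ b3 ≤∷ 7≤c ≤∷ ≤-trans 7≤c c≤d ≤∷ []) ≤-refl

  -- Either some order exceeds 4 and the densities total at most 19/20, or all four equal 4 and N ∣
  -- 4. Leaving out column j keeps the argument uniform in its order.
  orders4 : 4 ≤ o a → o a ≤ o b → o b ≤ o c → o c ≤ o d → ⊥
  orders4 4≤a a≤b b≤c c≤d with ≤⇒≡⊎< (≤-trans 4≤a (≤-trans a≤b (≤-trans b≤c c≤d)))
  ... | inj₂ 5≤d = sparse {20} {5 ∷ 5 ∷ 5 ∷ 4 ∷ []}
    (4≤a ≤∷ ≤-trans 4≤a a≤b ≤∷ ≤-trans 4≤a (≤-trans a≤b b≤c) ≤∷ 5≤d ≤∷ []) ≤-refl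
  ... | inj₁ d4 = ∣⇒≱9 (exponentOfList {4} j (inj₁ refl ∷ a4 ! ∷ b4 ! ∷ c4 ! ∷ d4 ! ∷ [])) 9≤N
    where
    c4 : o c ≡ 4
    c4 = ≤-antisym (≤-trans c≤d (≤-reflexive d4)) (≤-trans 4≤a (≤-trans a≤b b≤c))
    b4 : o b ≡ 4
    b4 = ≤-antisym (≤-trans b≤c (≤-reflexive c4)) (≤-trans 4≤a a≤b)
    a4 : o a ≡ 4
    a4 = ≤-antisym (≤-trans a≤b (≤-reflexive b4)) 4≤a

  -- From 2 ≤ `o j` < `o a` the least order in the list is at least 3, and if it equals 3 then `o j`
  -- is 2.
  noSortedCovering : o j < o a → o a ≤ o b → o b ≤ o c → o c ≤ o d → ⊥
  noSortedCovering j<a a≤b b≤c c≤d with ≤⇒≡⊎< (≤-trans (s≤s 2≤ordj) j<a)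
  ... | inj₂ 4≤a = orders4 4≤a a≤b b≤c c≤d
  ... | inj₁ a3 with ≤⇒≡⊎< (≤-trans (≡⇒≥ a3) a≤b)
  ...   | inj₁ b3  = orders33 (≤-antisym (≤-pred (≤-trans j<a (≤-reflexive a3))) 2≤ordj) a3 b3 (≤-trans (≡⇒≥ b3) b≤c) c≤d
  ...   | inj₂ 4≤b = orders34 (≤-antisym (≤-pred (≤-trans j<a (≤-reflexive a3))) 2≤ordj) a3 4≤b b≤c c≤d

noCovering : ∀ {N} .{{_ : NonZero N}} → 9 ≤ N → (C : Covering N) → ∀ j → 2 ≤ ord C j →
             (∀ i → i ≢ j → ord C j < ord C i) → ⊥
noCovering {N} 9≤N C j 2≤j j<_ = pick (sort others) (sort-↭ others) (sort-↗ others)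
  where
  byOrder = On.decTotalOrder ≤-decTotalOrder (ord C)
  open import Data.List.Sort byOrder using (sort; sort-↭; sort-↗)
  open import Data.List.Relation.Unary.Sorted.TotalOrder (DecTotalOrder.totalOrder byOrder) using (Sorted)

  others : List (Fin 5)
  others = map (punchIn j) (allFin 4)

  pick : ∀ is → is ↭ others → Sorted is → ⊥
  pick (a ∷ b ∷ c ∷ d ∷ []) perm (a≤b ∷ b≤c ∷ c≤d ∷ [-]) =
    noSortedCovering 9≤N C j 2≤j a b c d complete (j<_ a a≢j) a≤b b≤c c≤d
    where
    complete : ∀ i → i ∈ j ∷ a ∷ b ∷ c ∷ d ∷ []
    complete i with j ≟ᶠ i
    ... | yes refl = here refl
    ... | no j≢i   = there (∈-resp-↭ (↭-sym perm)
      (subst (_∈ others) (punchIn-punchOut j≢i) (∈-map⁺ (punchIn j) (∈-allFin (punchOut j≢i)))))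
    a≢j : a ≢ j
    a≢j with ∈-map⁻ (punchIn j) (∈-resp-↭ perm (here refl))
    ... | k , _ , refl = punchInᵢ≢i j k
  pick []                      perm _ = contradiction (↭-length perm) λ ()
  pick (_ ∷ [])                perm _ = contradiction (↭-length perm) λ ()
  pick (_ ∷ _ ∷ [])            perm _ = contradiction (↭-length perm) λ ()
  pick (_ ∷ _ ∷ _ ∷ [])        perm _ = contradiction (↭-length perm) λ ()
  pick (_ ∷ _ ∷ _ ∷ _ ∷ _ ∷ _) perm _ = contradiction (↭-length perm) λ ()

-- From thin codes to coverings

sum-% : ∀ {n} N .{{_ : NonZero N}} (f : Fin n → ℕ) → sum (λ i → f i % N) % N ≡ sum f % N
sum-% {zero}  N f = refl
sum-% {suc n} N f = begin
  (f zero % N + tail%) % N           ≡⟨ %-distribˡ-+ (f zero % N) tail% N ⟩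
  (f zero % N % N + tail% % N) % N   ≡⟨ cong₂ (λ x y → (x + y) % N) (m%n%n≡m%n (f zero) N) (sum-% N (f ∘ suc)) ⟩
  (f zero % N + tail % N) % N        ≡⟨ %-distribˡ-+ (f zero) tail N ⟨
  (f zero + tail) % N                ∎
  where
  open ≡-Reasoning
  tail% = sum (λ i → f (suc i) % N)
  tail  = sum (f ∘ suc)

sum-lookup : ∀ {n} {A : Set} (f : A → ℕ) (w : Vec A n) → Vec.sum (Vec.map f w) ≡ sum (f ∘ lookup w)
sum-lookup f []      = refl
sum-lookup f (x ∷ w) = cong (f x +_) (sum-lookup f w)

module _ {N : ℕ} .{{_ : NonZero N}} (g : Matrix N 2 5) where

  column : Fin 5 → Point
  column i = toℕ (lookup (lookup g zero) i) , toℕ (lookup (lookup g (suc zero)) i)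

  combination : Point → Word N 5
  combination (a , b) = zipWith _+ₘ_ (Vec.map ((a mod N) *ₘ_) (lookup g zero))
                                     (Vec.map ((b mod N) *ₘ_) (lookup g (suc zero)))

  combination∈ : ∀ p → GeneratedCode g (combination p)
  combination∈ (a , b) = add (scale (a mod N) (row zero)) (scale (b mod N) (row (suc zero)))

  toℕ-mod : ∀ m → toℕ (m mod N) ≡ m % N
  toℕ-mod m = toℕ-fromℕ< (m%n<n m N)

  toℕ-*ₘ : ∀ a (x : ℤₘ N) → toℕ ((a mod N) *ₘ x) ≡ (a * toℕ x) % N
  toℕ-*ₘ a x = begin
    toℕ ((a mod N) *ₘ x)                ≡⟨ toℕ-mod _ ⟩
    (toℕ (a mod N) * toℕ x) % N         ≡⟨ cong (λ r → (r * toℕ x) % N) (toℕ-mod a) ⟩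
    (a % N * toℕ x) % N                 ≡⟨ %-distribˡ-* (a % N) (toℕ x) N ⟩
    (a % N % N * (toℕ x % N)) % N       ≡⟨ cong (λ r → (r * (toℕ x % N)) % N) (m%n%n≡m%n a N) ⟩
    (a % N * (toℕ x % N)) % N           ≡⟨ %-distribˡ-* a (toℕ x) N ⟨
    (a * toℕ x) % N                     ∎
    where open ≡-Reasoning

  toℕ-combination : ∀ p i → toℕ (lookup (combination p) i) ≡ (p · column i) % N
  toℕ-combination (a , b) i = begin
    toℕ (lookup (combination (a , b)) i)
      ≡⟨ cong toℕ (lookup-zipWith _+ₘ_ i (Vec.map ((a mod N) *ₘ_) (lookup g zero)) _) ⟩
    toℕ (lookup (Vec.map ((a mod N) *ₘ_) (lookup g zero)) i +ₘ lookup (Vec.map ((b mod N) *ₘ_) (lookup g (suc zero))) i)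
      ≡⟨ cong₂ (λ x y → toℕ (x +ₘ y)) (lookup-map i _ (lookup g zero)) (lookup-map i _ (lookup g (suc zero))) ⟩
    toℕ (((a mod N) *ₘ x) +ₘ ((b mod N) *ₘ y))
      ≡⟨ toℕ-mod _ ⟩
    (toℕ ((a mod N) *ₘ x) + toℕ ((b mod N) *ₘ y)) % N
      ≡⟨ cong₂ (λ s t → (s + t) % N) (toℕ-*ₘ a x) (toℕ-*ₘ b y) ⟩
    ((a * toℕ x) % N + (b * toℕ y) % N) % N
      ≡⟨ %-distribˡ-+ (a * toℕ x) (b * toℕ y) N ⟨
    (a * toℕ x + b * toℕ y) % N
      ≡⟨ cong (_% N) (·-def a b (toℕ x) (toℕ y)) ⟨
    ((a , b) · column i) % N
      ∎
    where
    open ≡-Reasoning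
    x = lookup (lookup g zero) i
    y = lookup (lookup g (suc zero)) i

  -- Reduction modulo N preserves divisibility by a divisor of N, so the property passes from the
  -- rows through every closure rule. This carries the content of the code back to the matrix.
  ∣entries : ∀ {c w} → c ∣ N → (∀ r i → c ∣ toℕ (lookup (lookup g r) i)) → GeneratedCode g w →
             ∀ i → c ∣ toℕ (lookup w i)
  ∣entries c∣N c∣g (row r) i = c∣g r i
  ∣entries {c} c∣N c∣g zeroʷ i =
    subst (c ∣_) (sym (trans (cong toℕ (lookup-replicate i 0ₘ)) (toℕ-mod 0))) (%-presˡ-∣ (c ∣0) c∣N)
  ∣entries {c} c∣N c∣g (add {v} {w} v∈ w∈) i =
    subst (c ∣_) (sym (trans (cong toℕ (lookup-zipWith _+ₘ_ i v w)) (toℕ-mod _)))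
      (%-presˡ-∣ (∣m∣n⇒∣m+n (∣entries c∣N c∣g v∈ i) (∣entries c∣N c∣g w∈ i)) c∣N)
  ∣entries {c} c∣N c∣g (scale s {w} w∈) i =
    subst (c ∣_) (sym (trans (cong toℕ (lookup-map i (s *ₘ_) w)) (toℕ-mod _)))
      (%-presˡ-∣ (∣n⇒∣m*n (toℕ s) (∣entries c∣N c∣g w∈ i)) c∣N)

  -- A point p lists the coefficients of a combination of the two rows, whose entries are the values
  -- of the column forms at p. If none of them vanished modulo N, that combination would be a word
  -- without zero entries.
  thin⇒covering : Admissible (GeneratedCode g) → Thin (GeneratedCode g) → Covering N
  thin⇒covering (extended , isGcd) (_ , noFullWord) = record
    { col     = column
    ; sumZero = sumZero
    ; content = content
    ; covers  = covers
    }
    where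
    open ≡-Reasoning
    sumZero : ∀ p → N ∣ sum (λ i → p · column i)
    sumZero p = m%n≡0⇒n∣m _ N (begin
      sum (λ i → p · column i) % N               ≡⟨ sum-% N (λ i → p · column i) ⟨
      sum (λ i → (p · column i) % N) % N         ≡⟨ cong (_% N) (sum-cong-≗ (toℕ-combination p)) ⟨
      sum (toℕ ∘ lookup (combination p)) % N     ≡⟨ cong (_% N) (sum-lookup toℕ (combination p)) ⟨
      Vec.sum (Vec.map toℕ (combination p)) % N  ≡⟨ extended (combination∈ p) ⟩
      0                                          ∎)

    content : ∀ {c} → c ∣ N → (∀ p i → c ∣ p · column i) → c ∣ 1
    content {c} c∣N c∣· = IsGCDOf.greatest isGcd
      λ { (inj₁ refl) → c∣N ; (inj₂ (w , i , w∈ , refl)) → ∣entries c∣N c∣g w∈ i }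
      where
      c∣g : ∀ r i → c ∣ toℕ (lookup (lookup g r) i)
      c∣g zero       i = subst (c ∣_) (trans (·-def 1 0 _ _) (trans (+-identityʳ _) (*-identityˡ _))) (c∣· (1 , 0) i)
      c∣g (suc zero) i = subst (c ∣_) (trans (·-def 0 1 _ _) (*-identityˡ _)) (c∣· (0 , 1) i)

    covers : ∀ p → ∃ λ i → N ∣ p · column i
    covers p with any? (λ i → N ∣? p · column i)
    ... | yes hit = hit
    ... | no ¬hit = contradiction (combination p , combination∈ p , lookup⁻ nonzero) noFullWord
      where
      nonzero : ∀ i → lookup (combination p) i ≢ 0ₘ
      nonzero i eq = ¬hit (i , m%n≡0⇒n∣m _ N (begin
        (p · column i) % N              ≡⟨ toℕ-combination p i ⟨
        toℕ (lookup (combination p) i)  ≡⟨ cong toℕ eq ⟩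
        toℕ (0 mod N)                   ≡⟨ toℕ-mod 0 ⟩
        0 % N                           ≡⟨ m<n⇒m%n≡m (>-nonZero⁻¹ N) ⟩
        0                               ∎))

-- Order and gcd have the constant product N, so a smaller gcd means a larger order.
order-anti-< : ∀ N .{{_ : NonZero N}} c c′ → pointGcd N c < pointGcd N c′ → order N c′ < order N c
order-anti-< N c c′ lt = ≰⇒> λ le → <-irrefl (trans (sym (N≡order*pointGcd N c)) (N≡order*pointGcd N c′))
  (≤-<-trans (*-monoˡ-≤ (pointGcd N c) le) (*-monoʳ-< (order N c′) {{order≢0 N c′}} lt))

order-unique : ∀ N .{{_ : NonZero N}} c α .{{_ : NonZero α}} → α ∣ N → pointGcd N c ≡ N / α → order N c ≡ α
order-unique N c α α∣N eq = *-cancelʳ-≡ (order N c) α (pointGcd N c) {{≢-nonZero gcd≢0}} (begin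
  order N c * pointGcd N c ≡⟨ N≡order*pointGcd N c ⟨
  N                        ≡⟨ m/n*n≡m α∣N ⟨
  N / α * α                ≡⟨ *-comm (N / α) α ⟩
  α * (N / α)              ≡⟨ cong (α *_) eq ⟨
  α * pointGcd N c         ∎)
  where
  open ≡-Reasoning
  gcd≢0 : pointGcd N c ≢ 0
  gcd≢0 ≡0 = ≢-nonZero⁻¹ N (0∣⇒≡0 (subst (_∣ N) ≡0 (pointGcd∣N N c)))

lemma3p6 : (N α : ℕ) .{{_ : NonZero N}} .{{_ : NonZero α}} →
    9 ≤ N →
    α ≡ 2 ⊎ α ≡ 3 ⊎ α ≡ 4 →
    α ∣ N →
    (g : Matrix N 2 5) →
    Admissible (GeneratedCode g) →
    (∃ λ (j : Fin 5) → columnGcd g j ≡ N / α × (∀ i → i ≢ j → columnGcd g i < N / α)) →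
    ¬ HasZeroColumn g →
    ¬ Thin (GeneratedCode g)
lemma3p6 N α 9≤N α∈ α∣N g admissible (j , gcdj , gcd<) _ thin =
  noCovering 9≤N (thin⇒covering g admissible thin) j
    (subst (2 ≤_) (sym (order-unique N (column g j) α α∣N gcdj)) (2≤α α∈))
    λ i i≢j → order-anti-< N (column g i) (column g j) (subst (columnGcd g i <_) (sym gcdj) (gcd< i i≢j))
  where
  2≤α : α ≡ 2 ⊎ α ≡ 3 ⊎ α ≡ 4 → 2 ≤ α
  2≤α (inj₁ refl)        = from-yes (2 ≤? 2)
  2≤α (inj₂ (inj₁ refl)) = from-yes (2 ≤? 3)
  2≤α (inj₂ (inj₂ refl)) = from-yes (2 ≤? 4)
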